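{- For every graph $G$ with at least one vertex and every $S\subseteq V(G)$, \[\operatorname{tn}(G,S)-1\leq \operatorname{tw}(G,S)\leq 10\max\{\operatorname{tn}(G,S),2\}-12.\]
   Context: A separation of $G$ is a pair $(A,B)$ of subgraphs of $G$ with $A\cup B=G$ and $E(A\cap B)=\emptyset$; its order is $|V(A)\cap V(B)|$. For a positive integer $k$, a tangle of order $k$ in $G$ is a family $\mathcal T$ of separations of $G$ of order less than $k$ such that: (T1) for every separation $(A,B)$ of order at most $k-1$, $(A,B)\in\mathcal T$ or $(B,A)\in\mathcal T$; (T2) for all $(A_1,B_1),(A_2,B_2),(A_3,B_3)\in\mathcal T$, $A_1\cup A_2\cup A_3\neq G$; (T3) for every $(A,B)\in\mathcal T$, $V(A)\ne V(G)$. It is a tangle of $(G,S)$ if moreover (T4) for every $(A,B)\in\mathcal T$, $S\not\subseteq V(A)$. $\operatorname{tn}(G,S)$ is the maximum order of a tangle of $(G,S)$. A tree decomposition of a graph $H$ is a pair $(T,(W_x\mid x\in V(T)))$ with $T$ a non-null tree and bags $W_x\subseteq V(H)$ such that each edge of $H$ lies in some bag and for each vertex $v$ the set $\{x: v\in W_x\}$ induces a non-empty subtree; its width is $\max_x|W_x|-1$. A tree decomposition of $(G,S)$ is a tree decomposition $\mathcal B$ of some induced subgraph $H$ of $G$ with $S\subseteq V(H)$ such that for every component $C$ of $G-V(H)$ some bag of $\mathcal B$ contains all neighbours of $V(C)$ in $G$. $\operatorname{tw}(G,S)$ is the minimum width of a tree decomposition of $(G,S)$. -}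

module Defs where

open import Data.Nat using (ℕ; zero; suc; _≤_; _<_; _∸_; _⊔_)
open import Data.Integer using (ℤ; _⊖_)
open import Data.Bool using (Bool; true; false)
open import Data.Fin using (Fin)
open import Data.Fin.Subset using (Subset; _∈_; _∉_; _⊆_; _∩_; ∣_∣)
open import Data.List using (List; []; _∷_; length; _∷ʳ_)
open import Data.List.Relation.Unary.Linked using (Linked)
open import Data.List.Relation.Unary.Unique.Propositional using (Unique)
open import Data.Product using (Σ; ∃; ∃-syntax; _×_; _,_)
open import Data.Sum using (_⊎_)
open import Data.Empty using (⊥)
open import Data.Unit using (⊤)
open import Relation.Nullary using (¬_)
open import Relation.Binary.PropositionalEquality using (_≡_)

record Graph : Set where
  field
    n      : ℕ
    adj    : Fin n → Fin n → Bool
    sym    : ∀ u v → adj u v ≡ adj v u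
    irrefl : ∀ v → adj v v ≡ false

open Graph public

data WalkIn {m : ℕ} (a : Fin m → Fin m → Bool) (P : Fin m → Set)
     : Fin m → Fin m → Set where
  here : ∀ {v} → P v → WalkIn a P v v
  step : ∀ {u w v} → P u → a u w ≡ true → WalkIn a P w v → WalkIn a P u v

ConnectedIn : (G : Graph) → (Fin (n G) → Set) → Set
ConnectedIn G P = ∀ u v → P u → P v → WalkIn (adj G) P u v

IsCycle : (G : Graph) → Fin (n G) → List (Fin (n G)) → Set
IsCycle G x xs =
  Unique (x ∷ xs) × 2 ≤ length xs
  × Linked (λ a b → adj G a b ≡ true) ((x ∷ xs) ∷ʳ x)

IsTree : Graph → Set
IsTree T = 1 ≤ n T × ConnectedIn T (λ _ → ⊤)
  × (∀ x xs → ¬ IsCycle T x xs)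

record Subgraph (G : Graph) : Set where
  field
    V    : Subset (n G)
    E    : Fin (n G) → Fin (n G) → Bool
    Esym : ∀ u v → E u v ≡ E v u
    E⊆   : ∀ u v → E u v ≡ true → adj G u v ≡ true
    Eend : ∀ u v → E u v ≡ true → u ∈ V × v ∈ V

open Subgraph public

record Separation (G : Graph) : Set where
  field
    A B    : Subgraph G
    coverV : ∀ v → v ∈ V A ⊎ v ∈ V B
    coverE : ∀ u v → adj G u v ≡ true → E A u v ≡ true ⊎ E B u v ≡ true
    disjE  : ∀ u v → E A u v ≡ true → E B u v ≡ true → ⊥

open Separation public

swap : {G : Graph} → Separation G → Separation G
swap s = record
  { A = B s ; B = A s
  ; coverV = λ v → Data.Sum.swap (coverV s v)
  ; coverE = λ u v e → Data.Sum.swap (coverE s u v e)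
  ; disjE = λ u v eb ea → disjE s u v ea eb }

order : {G : Graph} → Separation G → ℕ
order s = ∣ V (A s) ∩ V (B s) ∣

Union3IsG : (G : Graph) → Subgraph G → Subgraph G → Subgraph G → Set
Union3IsG G A₁ A₂ A₃ =
  (∀ v → v ∈ V A₁ ⊎ v ∈ V A₂ ⊎ v ∈ V A₃)
  × (∀ u v → adj G u v ≡ true →
       E A₁ u v ≡ true ⊎ E A₂ u v ≡ true ⊎ E A₃ u v ≡ true)

record IsTangle (G : Graph) (S : Subset (n G)) (k : ℕ)
                (𝒯 : Separation G → Set) : Set where
  field
    ord : ∀ s → 𝒯 s → order s < k
    T1  : ∀ s → order s ≤ k ∸ 1 → 𝒯 s ⊎ 𝒯 (swap s)
    T2  : ∀ s₁ s₂ s₃ → 𝒯 s₁ → 𝒯 s₂ → 𝒯 s₃ →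
            ¬ Union3IsG G (A s₁) (A s₂) (A s₃)
    T3  : ∀ s → 𝒯 s → ¬ (∀ v → v ∈ V (A s))
    T4  : ∀ s → 𝒯 s → ¬ (S ⊆ V (A s))

HasTangle : (G : Graph) → Subset (n G) → ℕ → Set₁
HasTangle G S k = Σ (Separation G → Set) (IsTangle G S k)

IsTn : (G : Graph) → Subset (n G) → ℕ → Set₁
IsTn G S t = (∀ k → 1 ≤ k → HasTangle G S k → k ≤ t)
           × (t ≡ 0 ⊎ (1 ≤ t × HasTangle G S t))

IsComponentOutside : (G : Graph) → Subset (n G) → Subset (n G) → Set
IsComponentOutside G X C =
  (∃[ c ] c ∈ C)
  × (∀ v → v ∈ C → v ∉ X)
  × ConnectedIn G (_∈ C)
  × (∀ c v → c ∈ C → v ∉ X → adj G c v ≡ true → v ∈ C)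

record TreeDecomposition (G : Graph) (S : Subset (n G)) : Set where
  field
    X      : Subset (n G)          -- V(H), H = G[X]
    S⊆X    : S ⊆ X
    T      : Graph
    isTree : IsTree T
    W      : Fin (n T) → Subset (n G)
    W⊆X    : ∀ x → W x ⊆ X
    edge   : ∀ u v → u ∈ X → v ∈ X → adj G u v ≡ true →
               ∃[ x ] (u ∈ W x × v ∈ W x)
    vtxNe  : ∀ v → v ∈ X → ∃[ x ] v ∈ W x
    vtxCon : ∀ v → v ∈ X → ConnectedIn T (λ x → v ∈ W x)
    comp   : ∀ C → IsComponentOutside G X C →
               Σ (Fin (n T)) λ x → (∀ v → v ∉ C → (∃[ c ] (c ∈ C × adj G c v ≡ true))
                          → v ∈ W x)

open TreeDecomposition public

maxOver : (m : ℕ) → (Fin m → ℕ) → ℕ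
maxOver zero    f = 0
maxOver (suc m) f = f Fin.zero ⊔ maxOver m (λ i → f (Fin.suc i))

width : {G : Graph} {S : Subset (n G)} → TreeDecomposition G S → ℤ
width 𝒟 = maxOver (n (T 𝒟)) (λ x → ∣ W 𝒟 x ∣) ⊖ 1

IsTw : (G : Graph) → Subset (n G) → ℤ → Set
IsTw G S w = (Σ (TreeDecomposition G S) λ 𝒟 → width 𝒟 ≡ w)
           × (∀ (𝒟 : TreeDecomposition G S) → w Data.Integer.≤ width 𝒟)

{-# OPTIONS --safe #-}
-- Lower bound.  Suppose all bags of a tree decomposition are smaller than the order of a tangle.
-- Small sides of separations sharing a bag W x as boundary can be merged, and their union
-- cannot contain S, so every node x has a neighbour in whose direction the big side lies.
-- By (T2) two adjacent nodes never point at each other, so following the directions never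
-- backtracks and produces a cycle in the tree.
--
-- Upper bound.  Let θ = max(t , 2).  Leaves are added to a decomposition while every component C
-- of G − X meeting S has at most 3 θ + 1 neighbours.  If |N(C)| is smaller, one vertex of C
-- is added.  Otherwise, as no tangle of order θ + 1 exists, some separation (A , B) of order at most θ
-- has more than θ vertices of N(C) on both sides, or at most θ of them on a side containing S.
-- Adding C ∩ V(A) ∩ V(B) to N(C) gives a bag of size at most 4 θ + 1 ≤ 10 θ − 11, and the remaining
-- components that meet S again have at most 3 θ + 1 neighbours.
-- The conclusion is decidable, so existence is only needed up to double negation.
module Submission where

open import Defs
open import Data.Nat using (ℕ; zero; suc; _+_; _*_; _≤_; _<_; _⊔_; z≤n; s≤s; _≤?_)
open import Data.Nat.Properties
  using (≤-trans; ≤-reflexive; ≰⇒>; n≮n; n≤1+n; m≤m+n; m≤n+m; m≤n⇒m<n∨m≡n; +-suc; +-comm;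
         +-identityʳ; +-monoˡ-≤; +-monoʳ-≤; +-mono-≤; +-cancelˡ-≤; m≤m⊔n; m≤n⊔m; ⊔-lub)
open import Data.Nat.Induction using (<-wellFounded)
open import Data.Nat.Tactic.RingSolver using (solve-∀)
open import Data.Integer using (ℤ; _⊖_)
import Data.Integer.Properties as ℤ
open import Data.Integer.Properties using (⊖-monoˡ-≤; +-cancelˡ-⊖)
open import Data.Bool using (Bool; true; false; _∨_; _∧_; not)
open import Data.Bool.Properties using (∨-comm; ∧-conicalˡ; ∧-conicalʳ)
open import Data.Fin as Fin using (Fin; zero; suc)
open import Data.Fin.Properties as Finₚ using (_≟_; injective⇒≤; any?)
open import Data.Fin.Subset
  using (Subset; _∈_; _∉_; _⊆_; _∩_; _∪_; ∁; ⁅_⁆; ∣_∣; inside; outside)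
  renaming (⊥ to ∅)
open import Data.Fin.Subset.Properties
open import Data.List using (List; []; _∷_; length; _∷ʳ_; lookup; map)
open import Data.List.Properties using (map-++)
open import Data.List.Membership.Propositional using () renaming (_∈_ to _∈ˡ_)
open import Data.List.Membership.Propositional.Properties using (∈-lookup)
import Data.List.Membership.DecPropositional as DecMembership
open import Data.List.Relation.Unary.All as All using (All; []; _∷_)
open import Data.List.Relation.Unary.AllPairs using ([]; _∷_)
open import Data.List.Relation.Unary.Any using (here; there)
open import Data.List.Relation.Unary.Linked using (Linked; [-]; _∷_)
open import Data.List.Relation.Unary.Linked.Properties using () renaming (map⁻ to Linked-map⁻)
open import Data.List.Relation.Unary.Unique.Propositional using (Unique)
open import Data.List.Relation.Unary.Unique.Propositional.Properties using () renaming (map⁻ to Unique-map⁻)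
open import Data.Product as Product using (Σ; ∃; ∃-syntax; _×_; _,_; proj₁; proj₂)
open import Data.Sum as Sum using (_⊎_; inj₁; inj₂; [_,_]′)
open import Data.Empty using (⊥; ⊥-elim)
open import Data.Unit using (⊤; tt)
open import Data.Vec using ([]; _∷_; here; there)
open import Induction.WellFounded using (Acc; acc)
open import Function using (_∘_; id; case_of_)
open import Relation.Nullary using (¬_; Dec; yes; no; contradiction)
open import Relation.Nullary.Decidable using (¬¬-excluded-middle; does; dec-true; decidable-stable; _×-dec_; ¬?)
open import Relation.Binary.Definitions using (tri<; tri≈; tri>)
open import Relation.Binary.PropositionalEquality
  using (_≡_; _≢_; refl; trans; cong; cong₂; subst; ≢-sym) renaming (sym to ≡-sym)

-- Classical reasoning over finite types

¬¬-Π : ∀ {m} {P : Fin m → Set} → (∀ i → ¬ ¬ P i) → ¬ ¬ (∀ i → P i)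
¬¬-Π {zero}  h k = k λ ()
¬¬-Π {suc m} h k = h zero λ p₀ → ¬¬-Π (h ∘ suc) λ p →
  k λ { zero → p₀ ; (suc i) → p i }

Represents : ∀ {m} → Subset m → (Fin m → Set) → Set
Represents C P = ∀ v → (v ∈ C → P v) × (P v → v ∈ C)

decidable⇒subset : ∀ {m} {P : Fin m → Set} → (∀ i → Dec (P i)) →
  Σ (Subset m) λ C → Represents C P
decidable⇒subset {zero} P? = [] , λ ()
decidable⇒subset {suc m} {P} P? with P? zero | decidable⇒subset (P? ∘ suc)
... | yes p | C , hC = inside ∷ C , λ
  { zero    → (λ _ → p) , (λ _ → here)
  ; (suc i) → (λ { (there q) → proj₁ (hC i) q }) , (there ∘ proj₂ (hC i)) }
... | no ¬p | C , hC = outside ∷ C , λ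
  { zero    → (λ ()) , (λ p → contradiction p ¬p)
  ; (suc i) → (λ { (there q) → proj₁ (hC i) q }) , (there ∘ proj₂ (hC i)) }

-- Components and similar sets arise as predicates with no decision procedure at hand. They become a
-- `Subset` only under double negation, which suffices for goals that are `⊥` or decidable.
comprehension : ∀ {m} (P : Fin m → Set) → ¬ ¬ Σ (Subset m) λ C → Represents C P
comprehension P k = ¬¬-Π {P = λ i → Dec (P i)} (λ _ → ¬¬-excluded-middle) (k ∘ decidable⇒subset)

-- A canonical choice: predicates that agree have the same least element, so all vertices of a
-- component will pick the same node.
Least : ∀ {m} → (Fin m → Set) → Fin m → Set
Least P z = P z × (∀ z′ → z′ Fin.< z → ¬ P z′)

least : ∀ {m} {P : Fin m → Set} → (∀ i → Dec (P i)) → ∃ P → ∃ (Least P)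
least {suc m} {P} P? (z , p) with P? zero
... | yes p₀ = zero , p₀ , λ _ ()
... | no ¬p₀ with z | p
...   | zero  | p′ = contradiction p′ ¬p₀
...   | suc i | p′ with least (P? ∘ suc) (i , p′)
...     | j , pj , min = suc j , pj , λ { zero _ → ¬p₀ ; (suc z′) (s≤s z′<j) → min z′ z′<j }

least-unique : ∀ {m} {P : Fin m → Set} {i j} → Least P i → Least P j → i ≡ j
least-unique {i = i} {j} (pi , mini) (pj , minj) with Finₚ.<-cmp i j
... | tri< i<j _ _ = contradiction pi (minj i i<j)
... | tri≈ _ eq _ = eq
... | tri> _ _ j<i = contradiction pj (mini j j<i)

-- Walks and cycles

module _ {m : ℕ} {a : Fin m → Fin m → Bool} where

  map-walk : ∀ {P Q : Fin m → Set} → (∀ {v} → P v → Q v) →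
    ∀ {u v} → WalkIn a P u v → WalkIn a Q u v
  map-walk f (here p)      = here (f p)
  map-walk f (step p e w) = step (f p) e (map-walk f w)

  walk-start : ∀ {P u v} → WalkIn a P u v → P u
  walk-start (here p)     = p
  walk-start (step p _ _) = p

  walk-end : ∀ {P u v} → WalkIn a P u v → P v
  walk-end (here p)     = p
  walk-end (step _ _ w) = walk-end w

  append : ∀ {P u v w} → WalkIn a P u v → WalkIn a P v w → WalkIn a P u w
  append (here _)     q = q
  append (step p e w) q = step p e (append w q)

  snoc : ∀ {P u v w} → WalkIn a P u v → a v w ≡ true → P w → WalkIn a P u w
  snoc w e p = append w (step (walk-end w) e (here p))

  -- Each vertex on the walk is reached from `s` by an initial part of it. This shows that a
  -- reachability class is connected within itself.
  prefixes : ∀ {P s u v} → WalkIn a P s u → WalkIn a P u v →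
    WalkIn a (WalkIn a P s) u v
  prefixes w₀ (here _)     = here w₀
  prefixes w₀ (step _ e w) = step w₀ e (prefixes (snoc w₀ e (walk-start w)) w)

  invariant : ∀ {P Q : Fin m → Set} →
    (∀ {u v} → P u → P v → a u v ≡ true → Q u → Q v) →
    ∀ {u v} → WalkIn a P u v → Q u → Q v
  invariant h (here _)     q = q
  invariant h (step p e w) q = invariant h w (h p (walk-start w) e q)

  -- Cut the walk after its last visit to `x`. In a tree the node that follows names the branch at
  -- `x` containing `z`.
  last-exit : ∀ {P} x {u z} → z ≢ x → WalkIn a P u z →
    WalkIn a (λ v → P v × v ≢ x) u z
    ⊎ ∃[ w ] (a x w ≡ true × WalkIn a (λ v → P v × v ≢ x) w z)
  last-exit x z≢x (here p) = inj₁ (here (p , z≢x))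
  last-exit x {u} z≢x (step p e w) with last-exit x z≢x w
  ... | inj₂ r = inj₂ r
  ... | inj₁ w′ with u ≟ x
  ...   | yes refl = inj₂ (_ , e , w′)
  ...   | no u≢x   = inj₁ (step (p , u≢x) e w′)

reverse-walk : ∀ (G : Graph) {P u v} → WalkIn (adj G) P u v → WalkIn (adj G) P v u
reverse-walk G (here p)     = here p
reverse-walk G (step p e w) =
  snoc (reverse-walk G w) (trans (sym G _ _) e) p

data Path {A : Set} (R : A → A → Set) : A → A → List A → Set where
  []  : ∀ {u} → Path R u u []
  _∷_ : ∀ {u w v xs} → R u w → Path R w v xs → Path R u v (w ∷ xs)

close : ∀ {A : Set} {R : A → A → Set} {u v x xs} →
  Path R u v xs → R v x → Linked R ((u ∷ xs) ∷ʳ x)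
close []      e = e ∷ [-]
close (r ∷ p) e = r ∷ close p e

map-path : ∀ {A : Set} {R Q : A → A → Set} → (∀ {a b} → R a b → Q a b) →
  ∀ {u v xs} → Path R u v xs → Path Q u v xs
map-path f []      = []
map-path f (r ∷ p) = f r ∷ map-path f p

path-suffix : ∀ {A : Set} {R : A → A → Set} {P : A → Set} {u v x ys} →
  Path R u v ys → Unique (u ∷ ys) → All P (u ∷ ys) → x ∈ˡ u ∷ ys →
  ∃[ xs ] (Path R x v xs × Unique (x ∷ xs) × All P (x ∷ xs))
path-suffix p       un       al       (here refl) = _ , p , un , al
path-suffix (_ ∷ p) (_ ∷ un) (_ ∷ al) (there i)   = path-suffix p un al i

path-prefix : ∀ {A : Set} {R : A → A → Set} {u v x ys} →
  Path R u v ys → Unique (u ∷ ys) → x ∈ˡ u ∷ ys →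
  ∃[ xs ] (Path R u x xs × Unique (u ∷ xs) × (∀ {Q : A → Set} → All Q ys → All Q xs))
path-prefix p un (here refl) = [] , [] , [] ∷ [] , λ _ → []
path-prefix (r ∷ p) (u∉ ∷ un) (there i) with path-prefix p un i
... | xs , p′ , un′ , sub = _ , r ∷ p′ , sub′ u∉ ∷ un′ , sub′
  where
  sub′ : ∀ {Q} → All Q _ → All Q _
  sub′ (q ∷ qs) = q ∷ sub qs

_∈ˡ?_ : ∀ {m} (x : Fin m) (l : List (Fin m)) → Dec (x ∈ˡ l)
_∈ˡ?_ = DecMembership._∈?_ _≟_

walk⇒path : ∀ {m} {a : Fin m → Fin m → Bool} {P u v} → WalkIn a P u v →
  ∃[ xs ] (Path (λ x y → a x y ≡ true) u v xs × Unique (u ∷ xs) × All P (u ∷ xs))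
walk⇒path (here p) = [] , [] , [] ∷ [] , p ∷ []
walk⇒path {u = u} (step {w = w} p e q) with walk⇒path q
... | ys , path , un , al with u ∈ˡ? (w ∷ ys)
...   | yes i = path-suffix path un al i
...   | no ¬i = _ , e ∷ path , All.tabulate (λ {x} x∈ eq → ¬i (subst (_∈ˡ _) (≡-sym eq) x∈)) ∷ un
              , p ∷ al

lookup-injective : ∀ {A : Set} {xs : List A} → Unique xs → ∀ {i j} →
  lookup xs i ≡ lookup xs j → i ≡ j
lookup-injective (_ ∷ _)  {zero}  {zero}  _  = refl
lookup-injective (x∉ ∷ _) {zero}  {suc j} eq = contradiction eq (All.lookup x∉ (∈-lookup j))
lookup-injective (x∉ ∷ _) {suc i} {zero}  eq = contradiction (≡-sym eq) (All.lookup x∉ (∈-lookup i))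
lookup-injective (_ ∷ un) {suc i} {suc j} eq = cong suc (lookup-injective un eq)

unique-length : ∀ {m} {xs : List (Fin m)} → Unique xs → length xs ≤ m
unique-length un = injective⇒≤ (lookup-injective un)

-- After its last visit to `x`, the walk `q` continues from a neighbour `w` of `x` with `w ≢ y`.
-- Joined to `p` this gives a path from `y` to `w` avoiding `x`, which closes to a cycle through
-- `x`.
sides-disjoint : ∀ {T} → IsTree T → ∀ {x y z} → adj T x y ≡ true →
  WalkIn (adj T) (_≢ x) y z → WalkIn (adj T) (_≢ y) x z → ⊥
sides-disjoint {T} (_ , _ , acyclic) {x} {y} xy p q with last-exit x (walk-end p) q
... | inj₁ q′ = proj₂ (walk-start q′) refl
... | inj₂ (w , xw , q′)
  with walk⇒path (append p (reverse-walk T (map-walk proj₂ q′)))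
...   | []     , []   , _  , _  = proj₁ (walk-start q′) refl
...   | _ ∷ _ , path , un , al = acyclic x (y ∷ _)
  ( All.map ≢-sym al ∷ un
  , s≤s (s≤s z≤n)
  , xy ∷ close path (trans (sym T w x) xw))

non-backtracking⇒cycle : ∀ T (f : Fin (n T) → Fin (n T)) →
  (∀ x → adj T x (f x) ≡ true) → (∀ x → f (f x) ≢ x) →
  Fin (n T) → ∃[ x ] ∃[ xs ] IsCycle T x xs
non-backtracking⇒cycle T f x~fx ffx≢x x₀ = extend (n T) x₀ [] [] ([] ∷ []) refl
  where
  R : Fin (n T) → Fin (n T) → Set
  R u v = u ≡ f v

  R⇒adj : ∀ {u v} → R u v → adj T u v ≡ true
  R⇒adj refl = trans (sym T _ _) (x~fx _)

  -- The list `y ∷ ys` holds distinct iterates of `f`, the latest first. Once the fuel `k` is spent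
  -- it would have `n T + 1` entries, so `f y` must repeat before that.
  extend : ∀ k y ys → Path R y x₀ ys → Unique (y ∷ ys) → length ys + k ≡ n T →
    ∃[ x ] ∃[ xs ] IsCycle T x xs
  extend zero y ys p un eq =
    contradiction (subst (suc (length ys) ≤_) (trans (≡-sym eq) (+-identityʳ _)) (unique-length un)) (n≮n _)
  extend (suc k) y ys p un eq with f y ∈ˡ? (y ∷ ys)
  ... | no ¬i = extend k (f y) (y ∷ ys) (refl ∷ p)
    (All.tabulate (λ x∈ e → ¬i (subst (_∈ˡ _) (≡-sym e) x∈)) ∷ un)
    (trans (≡-sym (+-suc (length ys) k)) eq)
  ... | yes i with path-prefix p un i
  ...   | xs , p′ , un′ , _ = y , xs , un′ , long p′ refl , close (map-path R⇒adj p′) (trans (sym T _ _) (x~fx y))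
    where
    -- The cycle has at least three nodes, since `f y ≢ y` (no loops) and `f (f y) ≢ y`.
    long : ∀ {z xs} → Path R y z xs → z ≡ f y → 2 ≤ length xs
    long []            e = contradiction (trans (≡-sym (x~fx y)) (trans (cong (adj T y) (≡-sym e)) (irrefl T y))) λ ()
    long (r ∷ [])      refl = contradiction (≡-sym r) (ffx≢x y)
    long (_ ∷ _ ∷ _)   _ = s≤s (s≤s z≤n)

-- From a tangle to a large bag

-- A tree decomposition of all of G obtained from one of (G , S): every component of
-- G − X joins the first bag containing its neighbourhood.
record Completion {G : Graph} {S : Subset (n G)} (𝒟 : TreeDecomposition G S) : Set where
  field
    bag       : Fin (n (T 𝒟)) → Subset (n G)
    W⊆bag     : ∀ z v → v ∈ W 𝒟 z → v ∈ bag z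
    bag∩X⊆W   : ∀ z v → v ∈ X 𝒟 → v ∈ bag z → v ∈ W 𝒟 z
    covered   : ∀ v → ∃[ z ] v ∈ bag z
    edges     : ∀ u v → adj G u v ≡ true → ∃[ z ] (u ∈ bag z × v ∈ bag z)
    connected : ∀ v → ConnectedIn (T 𝒟) (λ z → v ∈ bag z)
    shared    : ∀ z z′ v → v ∈ bag z → v ∈ bag z′ → z ≢ z′ → v ∈ W 𝒟 z

module _ {G : Graph} {S : Subset (n G)} (𝒟 : TreeDecomposition G S) where

  Outside : Fin (n G) → Fin (n G) → Set
  Outside = WalkIn (adj G) (_∉ X 𝒟)

  -- For `v` outside `X 𝒟`, a node that can serve the component of `v` in `comp`. Phrased by
  -- reachability, it transfers along edges outside `X 𝒟`.
  Home : Fin (n G) → Fin (n (T 𝒟)) → Set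
  Home v z = ∀ u w → Outside v u → adj G u w ≡ true → w ∈ X 𝒟 → w ∈ W 𝒟 z

  component-of : ∀ {v C} → v ∉ X 𝒟 → Represents C (Outside v) → IsComponentOutside G (X 𝒟) C
  component-of {v} v∉X hC =
    (v , proj₂ (hC v) (here v∉X)) ,
    (λ u → walk-end ∘ proj₁ (hC u)) ,
    (λ u w u∈C w∈C → let p = proj₁ (hC u) u∈C in
      map-walk (proj₂ (hC _)) (prefixes p (append (reverse-walk G p) (proj₁ (hC w) w∈C)))) ,
    (λ c u c∈C u∉X e → proj₂ (hC u) (snoc (proj₁ (hC c) c∈C) e u∉X))

  home-exists : ∀ {v} → v ∉ X 𝒟 → ¬ ¬ ∃ (Home v)
  home-exists {v} v∉X k = comprehension (Outside v) λ (C , hC) →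
    let C-comp@(_ , C∩X , _ , _) = component-of v∉X hC
        z , hz = comp 𝒟 C C-comp
    in k (z , λ u w p e w∈X →
      hz w (λ w∈C → C∩X w w∈C w∈X) (u , proj₂ (hC u) p , e))

  completion : ¬ ¬ Completion 𝒟
  completion k =
    ¬¬-Π {P = λ v → ∀ z → Dec (Home v z)} (λ v → ¬¬-Π λ z → ¬¬-excluded-middle) λ home? →
    ¬¬-Π {P = λ v → v ∉ X 𝒟 → ∃ (Home v)}
      (λ v q → q λ v∉X → ⊥-elim (home-exists v∉X λ h → q λ _ → h)) λ home →
    ¬¬-Π (λ z → comprehension (λ v → v ∈ W 𝒟 z ⊎ (v ∉ X 𝒟 × Least (Home v) z))) λ bags →
    k (build (λ v v∉X → least (home? v) (home v v∉X)) (proj₁ ∘ bags) (proj₂ ∘ bags))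
    where
    build : (∀ v → v ∉ X 𝒟 → ∃ (Least (Home v))) → (bag : Fin (n (T 𝒟)) → Subset (n G)) →
      (∀ z → Represents (bag z) (λ v → v ∈ W 𝒟 z ⊎ (v ∉ X 𝒟 × Least (Home v) z))) →
      Completion 𝒟
    build home bag hbag = record
      { bag       = bag
      ; W⊆bag     = W⊆bag
      ; bag∩X⊆W   = bag∩X⊆W
      ; covered   = covered
      ; edges     = edges
      ; connected = connected
      ; shared    = shared }
      where
      W⊆bag : ∀ z v → v ∈ W 𝒟 z → v ∈ bag z
      W⊆bag z v = proj₂ (hbag z v) ∘ inj₁

      home∈bag : ∀ z v → v ∉ X 𝒟 → Least (Home v) z → v ∈ bag z
      home∈bag z v v∉X h = proj₂ (hbag z v) (inj₂ (v∉X , h))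

      bag∩X⊆W : ∀ z v → v ∈ X 𝒟 → v ∈ bag z → v ∈ W 𝒟 z
      bag∩X⊆W z v v∈X v∈bag with proj₁ (hbag z v) v∈bag
      ... | inj₁ v∈W       = v∈W
      ... | inj₂ (v∉X , _) = contradiction v∈X v∉X

      covered : ∀ v → ∃[ z ] v ∈ bag z
      covered v with v ∈? X 𝒟
      ... | yes v∈X = let z , v∈W = vtxNe 𝒟 v v∈X in z , W⊆bag z v v∈W
      ... | no v∉X  = let z , h = home v v∉X in z , home∈bag z v v∉X h

      home-adj : ∀ {u v} → u ∉ X 𝒟 → adj G u v ≡ true → ∀ {z} → Home u z → Home v z
      home-adj u∉X e h x w p = h x w (step u∉X e p)

      edges : ∀ u v → adj G u v ≡ true → ∃[ z ] (u ∈ bag z × v ∈ bag z)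
      edges u v e with u ∈? X 𝒟 | v ∈? X 𝒟
      ... | yes u∈X | yes v∈X = let z , u∈W , v∈W = edge 𝒟 u v u∈X v∈X e in
        z , W⊆bag z u u∈W , W⊆bag z v v∈W
      ... | yes u∈X | no v∉X = let z , h = home v v∉X in
        z , W⊆bag z u (proj₁ h v u (here v∉X) (trans (sym G v u) e) u∈X) , home∈bag z v v∉X h
      ... | no u∉X | yes v∈X = let z , h = home u u∉X in
        z , home∈bag z u u∉X h , W⊆bag z v (proj₁ h u v (here u∉X) e v∈X)
      ... | no u∉X | no v∉X = let z , h , min = home u u∉X in
        z , home∈bag z u u∉X (h , min) ,
        home∈bag z v v∉X (home-adj u∉X e h ,
          λ z′ z′<z → min z′ z′<z ∘ home-adj v∉X (trans (sym G v u) e))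

      connected : ∀ v → ConnectedIn (T 𝒟) (λ z → v ∈ bag z)
      connected v z z′ i j with v ∈? X 𝒟
      ... | yes v∈X = map-walk (W⊆bag _ v)
        (vtxCon 𝒟 v v∈X z z′ (bag∩X⊆W z v v∈X i) (bag∩X⊆W z′ v v∈X j))
      ... | no v∉X with proj₁ (hbag z v) i | proj₁ (hbag z′ v) j
      ...   | inj₁ v∈W     | _ = contradiction (W⊆X 𝒟 z v∈W) v∉X
      ...   | inj₂ _       | inj₁ v∈W = contradiction (W⊆X 𝒟 z′ v∈W) v∉X
      ...   | inj₂ (_ , h) | inj₂ (_ , h′) with refl ← least-unique h h′ = here i

      shared : ∀ z z′ v → v ∈ bag z → v ∈ bag z′ → z ≢ z′ → v ∈ W 𝒟 z
      -- A vertex outside `X 𝒟` is in one bag only. Thus distinct enlarged bags meet only inside the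
      -- old ones, and the small `W 𝒟 z` can serve as boundary.
      shared z z′ v i j z≢z′ with proj₁ (hbag z v) i | proj₁ (hbag z′ v) j
      ... | inj₁ v∈W       | _              = v∈W
      ... | inj₂ (v∉X , _) | inj₁ v∈W       = contradiction (W⊆X 𝒟 z′ v∈W) v∉X
      ... | inj₂ (_ , h)   | inj₂ (_ , h′) = contradiction (least-unique h h′) z≢z′

-- Separations along a small boundary

module _ {m : ℕ} where

  meets : Subset m → Fin m → Fin m → Bool
  meets U u v = does (u ∈? U) ∨ does (v ∈? U)

  meets-sym : ∀ U u v → meets U u v ≡ meets U v u
  meets-sym U u v = ∨-comm (does (u ∈? U)) (does (v ∈? U))

  meets⁻ : ∀ U u v → meets U u v ≡ true → u ∈ U ⊎ v ∈ U
  meets⁻ U u v e with u ∈? U | v ∈? U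
  ... | yes i | _     = inj₁ i
  ... | no _  | yes j = inj₂ j

  meets⁺ : ∀ U u v → u ∈ U ⊎ v ∈ U → meets U u v ≡ true
  meets⁺ U u v i with u ∈? U | v ∈? U
  ... | yes _ | _     = refl
  ... | no _  | yes _ = refl
  ... | no ¬i | no ¬j = contradiction i [ ¬i , ¬j ]′

module _ {G : Graph} where

  Closed : Subset (n G) → Subset (n G) → Set
  Closed Z U = ∀ u v → u ∈ U → adj G u v ≡ true → v ∈ U ∪ Z

  -- (G[U ∪ Z] without the edges inside Z , G − U)
  cut : (Z U : Subset (n G)) → Closed Z U → Separation G
  cut Z U closed = record
    { A = record
      { V = U ∪ Z
      ; E = λ u v → adj G u v ∧ meets U u v
      ; Esym = λ u v → cong₂ _∧_ (sym G u v) (meets-sym U u v)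
      ; E⊆ = λ u v → ∧-conicalˡ _ _
      ; Eend = λ u v e → ends u v (∧-conicalˡ _ _ e) (meets⁻ U u v (∧-conicalʳ (adj G u v) _ e)) }
    ; B = record
      { V = ∁ U
      ; E = λ u v → adj G u v ∧ not (meets U u v)
      ; Esym = λ u v → cong₂ _∧_ (sym G u v) (cong not (meets-sym U u v))
      ; E⊆ = λ u v → ∧-conicalˡ _ _
      ; Eend = λ u v e → let m = ∧-conicalʳ (adj G u v) _ e in
          x∉p⇒x∈∁p (λ i → not-both (meets⁺ U u v (inj₁ i)) m) ,
          x∉p⇒x∈∁p (λ i → not-both (meets⁺ U u v (inj₂ i)) m) }
    ; coverV = λ v → case v ∈? U of λ
        { (yes i) → inj₁ (x∈p∪q⁺ (inj₁ i)) ; (no ¬i) → inj₂ (x∉p⇒x∈∁p ¬i) }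
    ; coverE = coverE′
    ; disjE = λ u v e e′ → not-both (∧-conicalʳ (adj G u v) _ e) (∧-conicalʳ (adj G u v) _ e′) }
    where
    not-both : ∀ {b} → b ≡ true → not b ≡ true → ⊥
    not-both refl ()

    ends : ∀ u v → adj G u v ≡ true → u ∈ U ⊎ v ∈ U → u ∈ U ∪ Z × v ∈ U ∪ Z
    ends u v e (inj₁ i) = x∈p∪q⁺ (inj₁ i) , closed u v i e
    ends u v e (inj₂ j) = closed v u j (trans (sym G v u) e) , x∈p∪q⁺ (inj₁ j)

    coverE′ : ∀ u v → adj G u v ≡ true →
      adj G u v ∧ meets U u v ≡ true ⊎ adj G u v ∧ not (meets U u v) ≡ true
    coverE′ u v e rewrite e with meets U u v
    ... | true  = inj₁ refl
    ... | false = inj₂ refl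

  cut-order : ∀ Z U c → order (cut Z U c) ≤ ∣ Z ∣
  cut-order Z U c = p⊆q⇒∣p∣≤∣q∣ λ i →
    let l , r = x∈p∩q⁻ (U ∪ Z) (∁ U) i in
    case x∈p∪q⁻ U Z l of λ
      { (inj₁ j) → contradiction r (x∈p⇒x∉∁p j) ; (inj₂ j) → j }

  ⋃ : ∀ {k} → (Fin k → Subset (n G)) → Subset (n G)
  ⋃ {zero}  Us = ∅
  ⋃ {suc k} Us = Us zero ∪ ⋃ (Us ∘ suc)

  ∈⋃ : ∀ {k} (Us : Fin k → Subset (n G)) i {v} → v ∈ Us i → v ∈ ⋃ Us
  ∈⋃ Us zero    h = x∈p∪q⁺ (inj₁ h)
  ∈⋃ Us (suc i) h = x∈p∪q⁺ (inj₂ (∈⋃ (Us ∘ suc) i h))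

  closed-∅ : ∀ Z → Closed Z ∅
  closed-∅ Z u v i = contradiction i ∉⊥

  closed-∪ : ∀ Z U U′ → Closed Z U → Closed Z U′ → Closed Z (U ∪ U′)
  closed-∪ Z U U′ c c′ u v i e with x∈p∪q⁻ U U′ i
  ... | inj₁ j = x∈p∪q⁺ (Sum.map₁ (x∈p∪q⁺ ∘ inj₁) (x∈p∪q⁻ U Z (c u v j e)))
  ... | inj₂ j = x∈p∪q⁺ (Sum.map₁ (x∈p∪q⁺ ∘ inj₂) (x∈p∪q⁻ U′ Z (c′ u v j e)))

  module _ {S : Subset (n G)} {k : ℕ} {𝒯 : Separation G → Set}
           (tangle : IsTangle G S (suc k) 𝒯) (Z : Subset (n G)) (∣Z∣≤k : ∣ Z ∣ ≤ k) where
    open IsTangle tangle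

    cut-T1 : ∀ U c → 𝒯 (cut Z U c) ⊎ 𝒯 (swap (cut Z U c))
    cut-T1 U c = T1 _ (≤-trans (cut-order Z U c) ∣Z∣≤k)

    small-∅ : 𝒯 (cut Z ∅ (closed-∅ Z))
    small-∅ with cut-T1 ∅ (closed-∅ Z)
    ... | inj₁ t = t
    ... | inj₂ t = contradiction (λ v → x∉p⇒x∈∁p ∉⊥) (T3 _ t)

    -- If the union were not small, its opposite side would be. That side and the two given small
    -- sides cover `G`, against (T2).
    small-∪ : ∀ U U′ c c′ → 𝒯 (cut Z U c) → 𝒯 (cut Z U′ c′) →
      𝒯 (cut Z (U ∪ U′) (closed-∪ Z U U′ c c′))
    small-∪ U U′ c c′ t t′ with cut-T1 (U ∪ U′) (closed-∪ Z U U′ c c′)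
    ... | inj₁ t″ = t″
    ... | inj₂ t″ = contradiction (vertices , edges) (T2 _ _ _ t t′ t″)
      where
      vertices : ∀ v → v ∈ U ∪ Z ⊎ v ∈ U′ ∪ Z ⊎ v ∈ ∁ (U ∪ U′)
      vertices v with v ∈? U | v ∈? U′
      ... | yes i | _     = inj₁ (x∈p∪q⁺ (inj₁ i))
      ... | no _  | yes j = inj₂ (inj₁ (x∈p∪q⁺ (inj₁ j)))
      ... | no ¬i | no ¬j = inj₂ (inj₂ (x∉p⇒x∈∁p λ h → [ ¬i , ¬j ]′ (x∈p∪q⁻ U U′ h)))

      edges : ∀ u v → adj G u v ≡ true → adj G u v ∧ meets U u v ≡ true
        ⊎ adj G u v ∧ meets U′ u v ≡ true ⊎ adj G u v ∧ not (meets (U ∪ U′) u v) ≡ true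
      edges u v e rewrite e
        with meets U u v in eq | meets U′ u v in eq′ | meets (U ∪ U′) u v in eq″
      ... | true  | _     | _     = inj₁ refl
      ... | false | true  | _     = inj₂ (inj₁ refl)
      ... | false | false | false = inj₂ (inj₂ refl)
      -- This case cannot occur: a vertex in `U ∪ U′` contradicts `eq` or `eq′`, which yields the
      -- `false ≡ true` that the goal asks for.
      ... | false | false | true  with meets⁻ (U ∪ U′) u v eq″
      ...   | inj₁ i with x∈p∪q⁻ U U′ i
      ...     | inj₁ j = inj₁ (trans (≡-sym eq) (meets⁺ U u v (inj₁ j)))
      ...     | inj₂ j = inj₂ (inj₁ (trans (≡-sym eq′) (meets⁺ U′ u v (inj₁ j))))
      edges u v e | false | false | true | inj₂ i with x∈p∪q⁻ U U′ i
      ...     | inj₁ j = inj₁ (trans (≡-sym eq) (meets⁺ U u v (inj₂ j)))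
      ...     | inj₂ j = inj₂ (inj₁ (trans (≡-sym eq′) (meets⁺ U′ u v (inj₂ j))))

    -- If no index is big, the small sides are merged one by one, starting from the empty set.
    some-big : ∀ {m} (Us : Fin m → Subset (n G)) (c : ∀ i → Closed Z (Us i)) →
      (∃[ i ] 𝒯 (swap (cut Z (Us i) (c i)))) ⊎ (Σ (Closed Z (⋃ Us)) λ c′ → 𝒯 (cut Z (⋃ Us) c′))
    some-big {zero} Us c = inj₂ (closed-∅ Z , small-∅)
    some-big {suc m} Us c with cut-T1 (Us zero) (c zero) | some-big (Us ∘ suc) (c ∘ suc)
    ... | inj₂ t | _                = inj₁ (zero , t)
    ... | inj₁ _ | inj₁ (i , t)     = inj₁ (suc i , t)
    ... | inj₁ t | inj₂ (c′ , t′) = inj₂ (_ , small-∪ (Us zero) _ (c zero) c′ t t′)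

-- Orienting the tree by the tangle

module _ {G : Graph} {S : Subset (n G)} {k : ℕ} {𝒯 : Separation G → Set}
         (tangle : IsTangle G S (suc k) 𝒯) (𝒟 : TreeDecomposition G S)
         (∣W∣≤k : ∀ x → ∣ W 𝒟 x ∣ ≤ k) (𝒞 : Completion 𝒟) where
  open IsTangle tangle
  open Completion 𝒞

  private
    Node : Set
    Node = Fin (n (T 𝒟))

  Side : Node → Node → Node → Set
  Side x y z = WalkIn (adj (T 𝒟)) (_≢ x) y z

  Toward : Node → Node → Fin (n G) → Set
  Toward x y v = adj (T 𝒟) x y ≡ true × v ∉ bag x × ∃[ z ] (Side x y z × v ∈ bag z)

  -- The bags of `v` form a connected set of nodes missing `x`, so a single bag beyond `y` puts all
  -- of them there.
  toward-bags : ∀ {x y v z} → Toward x y v → v ∈ bag z → Side x y z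
  toward-bags {v = v} (_ , v∉bag , z′ , side , v∈bag) i =
    append side (map-walk (λ { j refl → v∉bag j }) (connected v _ _ v∈bag i))

  toward-exists : ∀ x v → v ∉ bag x → ∃[ y ] Toward x y v
  toward-exists x v v∉bag
    with z , v∈bag ← covered v
    with last-exit x (λ { refl → v∉bag v∈bag }) (proj₁ (proj₂ (isTree 𝒟)) x z tt tt)
  ... | inj₁ w            = contradiction refl (proj₂ (walk-start w))
  ... | inj₂ (y , xy , w) = y , xy , v∉bag , z , map-walk proj₂ w , v∈bag

  module _ (U : Node → Node → Subset (n G)) (hU : ∀ x y → Represents (U x y) (Toward x y)) where

    toward⇒ : ∀ {x y v} → v ∈ U x y → Toward x y v
    toward⇒ {x} {y} {v} = proj₁ (hU x y v)

    -- An edge at `u` lies in a bag beyond `y`. Its other end either avoids `bag x` and is toward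
    -- `y` too, or lies in both bags, and then `shared` puts it in `W 𝒟 x`.
    closed : ∀ x y → Closed {G} (W 𝒟 x) (U x y)
    closed x y u v u∈U e
      with toward@(xy , _) ← toward⇒ u∈U
      with z , u∈z , v∈z ← edges u v e
      with side ← toward-bags toward u∈z
      with v ∈? bag x
    ... | no v∉x  = x∈p∪q⁺ (inj₁ (proj₂ (hU x y v) (xy , v∉x , z , side , v∈z)))
    ... | yes v∈x = x∈p∪q⁺ (inj₂ (shared x z v v∈x v∈z (≢-sym (walk-end side))))

    Big : Node → Node → Set
    Big x y = 𝒯 (swap (cut (W 𝒟 x) (U x y) (closed x y)))

    -- If every branch at `x` were small, so would be their union. Together with `W 𝒟 x` it contains
    -- `S`, against (T4).
    big-neighbour : ∀ x → ∃ (Big x)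
    big-neighbour x with some-big tangle (W 𝒟 x) (∣W∣≤k x) (U x) (closed x)
    ... | inj₁ r       = r
    ... | inj₂ (c , t) = ⊥-elim (T4 _ t S⊆)
      where
      S⊆ : S ⊆ ⋃ (U x) ∪ W 𝒟 x
      S⊆ {v} v∈S with v ∈? bag x
      ... | yes i = x∈p∪q⁺ (inj₂ (bag∩X⊆W x v (S⊆X 𝒟 v∈S) i))
      ... | no ¬i with y , toward ← toward-exists x v ¬i =
        x∈p∪q⁺ (inj₁ (∈⋃ (U x) y (proj₂ (hU x y v) toward)))

    -- For non-adjacent nodes `U x y` is empty. Its complement contains every vertex and is no small
    -- side by (T3).
    big⇒adj : ∀ {x y} → Big x y → adj (T 𝒟) x y ≡ true
    big⇒adj {x} {y} t with any? (_∈? U x y)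
    ... | yes (_ , i) = proj₁ (toward⇒ i)
    ... | no ¬i       = contradiction (λ v → x∉p⇒x∈∁p λ i → ¬i (v , i)) (T3 _ t)

    toward-apart : ∀ {x y u v z} → u ∈ U x y → v ∈ U y x → u ∈ bag z → v ∈ bag z → ⊥
    toward-apart u∈U v∈U′ u∈z v∈z =
      sides-disjoint {T 𝒟} (isTree 𝒟) (proj₁ (toward⇒ u∈U))
        (toward-bags (toward⇒ u∈U) u∈z) (toward-bags (toward⇒ v∈U′) v∈z)

    -- No bag contains vertices of both `U x y` and `U y x`, so the two opposite sides cover `G`.
    -- This contradicts (T2) with one side used twice.
    big-antisym : ∀ {x y} → Big x y → Big y x → ⊥
    big-antisym {x} {y} t t′ = T2 _ _ _ t t′ t (vertices , edges′)
      where
      apart : ∀ {u v z} → u ∈ bag z × v ∈ bag z → u ∈ U x y → v ∉ U y x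
      apart (u∈z , v∈z) u∈U v∈U′ = toward-apart u∈U v∈U′ u∈z v∈z

      vertices : ∀ v → v ∈ ∁ (U x y) ⊎ v ∈ ∁ (U y x) ⊎ v ∈ ∁ (U x y)
      vertices v with v ∈? U x y
      ... | no ¬i = inj₁ (x∉p⇒x∈∁p ¬i)
      ... | yes i = let _ , v∈z = covered v in inj₂ (inj₁ (x∉p⇒x∈∁p (apart (v∈z , v∈z) i)))

      avoids : ∀ u v → adj G u v ≡ true → meets (U x y) u v ≡ true → meets (U y x) u v ≡ true → ⊥
      avoids u v e m m′ with z , u∈z , v∈z ← edges u v e
        with meets⁻ (U x y) u v m | meets⁻ (U y x) u v m′
      ... | inj₁ i | inj₁ j = apart (u∈z , u∈z) i j
      ... | inj₁ i | inj₂ j = apart (u∈z , v∈z) i j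
      ... | inj₂ i | inj₁ j = apart (v∈z , u∈z) i j
      ... | inj₂ i | inj₂ j = apart (v∈z , v∈z) i j

      edges′ : ∀ u v → adj G u v ≡ true → adj G u v ∧ not (meets (U x y) u v) ≡ true
        ⊎ adj G u v ∧ not (meets (U y x) u v) ≡ true ⊎ adj G u v ∧ not (meets (U x y) u v) ≡ true
      edges′ u v e with avoids u v e
      ... | av rewrite e with meets (U x y) u v | meets (U y x) u v
      ...   | false | _     = inj₁ refl
      ...   | true  | false = inj₂ (inj₁ refl)
      ...   | true  | true  = ⊥-elim (av refl refl)

    orientation-absurd : ⊥
    orientation-absurd =
      let x , xs , cycle = non-backtracking⇒cycle (T 𝒟) (proj₁ ∘ big-neighbour)
            (λ x → big⇒adj {x} (proj₂ (big-neighbour x))) no-return root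
      in proj₂ (proj₂ (isTree 𝒟)) x xs cycle
      where
      root : Node
      root = Fin.fromℕ< (proj₁ (isTree 𝒟))

      no-return : ∀ x → proj₁ (big-neighbour (proj₁ (big-neighbour x))) ≢ x
      no-return x eq = big-antisym {x} (proj₂ (big-neighbour x))
        (subst (Big _) eq (proj₂ (big-neighbour (proj₁ (big-neighbour x)))))

  small-bags-absurd : ⊥
  small-bags-absurd =
    ¬¬-Π (λ x → ¬¬-Π λ y → comprehension (Toward x y)) λ U →
      orientation-absurd (λ x y → proj₁ (U x y)) (λ x y → proj₂ (U x y))

tangle⇒large-bag : ∀ {G S k 𝒯} → IsTangle G S (suc k) 𝒯 → (𝒟 : TreeDecomposition G S) →
  ¬ (∀ x → ∣ W 𝒟 x ∣ ≤ k)
tangle⇒large-bag tangle 𝒟 h = completion 𝒟 (small-bags-absurd tangle 𝒟 h)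

-- Growing a tree decomposition leaf by leaf

module _ (T₀ : Graph) (p : Fin (n T₀)) where

  leaf-adj : Fin (suc (n T₀)) → Fin (suc (n T₀)) → Bool
  leaf-adj zero    zero    = false
  leaf-adj zero    (suc j) = does (j ≟ p)
  leaf-adj (suc i) zero    = does (i ≟ p)
  leaf-adj (suc i) (suc j) = adj T₀ i j

  addLeaf : Graph
  addLeaf = record
    { n      = suc (n T₀)
    ; adj    = leaf-adj
    ; sym    = λ { zero zero → refl ; zero (suc j) → refl ; (suc i) zero → refl ; (suc i) (suc j) → sym T₀ i j }
    ; irrefl = λ { zero → refl ; (suc i) → irrefl T₀ i } }

  zero-adj : ∀ {x} → leaf-adj zero x ≡ true → x ≡ suc p
  zero-adj {suc j} e with j ≟ p
  ... | yes refl = refl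

  adj-zero : ∀ {x} → leaf-adj x zero ≡ true → x ≡ suc p
  adj-zero {suc j} e with j ≟ p
  ... | yes refl = refl

  p-adj-zero : leaf-adj (suc p) zero ≡ true
  p-adj-zero = dec-true (p ≟ p) refl

  lift-walk : ∀ {P : Fin (n T₀) → Set} {Q : Fin (suc (n T₀)) → Set} → (∀ {i} → P i → Q (suc i)) →
    ∀ {i j} → WalkIn (adj T₀) P i j → WalkIn leaf-adj Q (suc i) (suc j)
  lift-walk f (here q)     = here (f q)
  lift-walk f (step q e w) = step (f q) e (lift-walk f w)

  private
    R : Fin (suc (n T₀)) → Fin (suc (n T₀)) → Set
    R x y = leaf-adj x y ≡ true

  last-adj : ∀ {x} z zs → Linked R ((z ∷ zs) ∷ʳ x) → ∃[ w ] (w ∈ˡ z ∷ zs × R w x)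
  last-adj z []        (r ∷ _) = z , here refl , r
  last-adj z (z′ ∷ zs) (_ ∷ l) = let w , i , r = last-adj z′ zs l in w , there i , r

  -- The only neighbour of the leaf is `suc p`. Inside the closed sequence its predecessor and
  -- successor would both be `suc p`, but they are distinct.
  avoids-leaf : ∀ {x a ys} → Linked R ((a ∷ ys) ∷ʳ x) → Unique (a ∷ ys) → x ≢ a →
    All (x ≢_) ys → a ≢ zero → All (_≢ zero) ys
  avoids-leaf {ys = []} _ _ _ _ _ = []
  avoids-leaf {ys = suc i ∷ ys} (_ ∷ l) (_ ∷ un) _ (x≢ ∷ x∉) _ =
    (λ ()) ∷ avoids-leaf l un x≢ x∉ (λ ())
  avoids-leaf {ys = zero ∷ []} (r ∷ r′ ∷ _) _ x≢a _ _ =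
    contradiction (trans (zero-adj r′) (≡-sym (adj-zero r))) x≢a
  avoids-leaf {ys = zero ∷ b ∷ ys} (r ∷ r′ ∷ _) ((_ ∷ a≢b ∷ _) ∷ _) _ _ _ =
    contradiction (trans (adj-zero r) (≡-sym (zero-adj r′))) a≢b

  lower : ∀ {ys : List (Fin (suc (n T₀)))} → All (_≢ zero) ys → ∃[ xs ] map suc xs ≡ ys
  lower [] = [] , refl
  lower {zero ∷ _} (≢0 ∷ _) = contradiction refl ≢0
  lower {suc i ∷ _} (_ ∷ al) with xs , refl ← lower al = i ∷ xs , refl

  leaf-acyclic : (∀ x xs → ¬ IsCycle T₀ x xs) → ∀ x xs → ¬ IsCycle addLeaf x xs
  leaf-acyclic acyclic x [] (_ , () , _)
  leaf-acyclic acyclic x (_ ∷ []) (_ , s≤s () , _)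
  leaf-acyclic acyclic zero (y ∷ z ∷ zs) (_ ∷ y∉ ∷ _ , _ , r ∷ _ ∷ l)
    with w , i , r′ ← last-adj z zs l =
    All.lookup y∉ i (trans (zero-adj r) (≡-sym (adj-zero r′)))
  leaf-acyclic acyclic (suc x) (zero ∷ z ∷ zs) ((_ ∷ x≢z ∷ _) ∷ _ , _ , r ∷ r′ ∷ _) =
    x≢z (trans (adj-zero r) (≡-sym (zero-adj r′)))
  leaf-acyclic acyclic (suc x) (suc y ∷ z ∷ zs) ((x≢y ∷ x∉) ∷ un , _ , r ∷ l)
    with lower (avoids-leaf l un x≢y x∉ (λ ()))
  ... | z′ ∷ xs , refl = acyclic x (y ∷ z′ ∷ xs)
    ( Unique-map⁻ ((x≢y ∷ x∉) ∷ un)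
    , s≤s (s≤s z≤n)
    , Linked-map⁻ (subst (λ l → Linked R (suc x ∷ suc y ∷ l)) (≡-sym (map-++ suc (z′ ∷ xs) (x ∷ []))) (r ∷ l)) )

  leaf-isTree : IsTree T₀ → IsTree addLeaf
  leaf-isTree (_ , con , acyclic) = s≤s z≤n , con′ , leaf-acyclic acyclic
    where
    con′ : ConnectedIn addLeaf (λ _ → ⊤)
    con′ zero    zero    _ _ = here tt
    con′ zero    (suc j) _ _ = step tt p-adj-zero (lift-walk _ (con p j tt tt))
    con′ (suc i) zero    _ _ = snoc (lift-walk _ (con i p tt tt)) p-adj-zero tt
    con′ (suc i) (suc j) _ _ = lift-walk _ (con i j tt tt)

Neighbour : (G : Graph) → Subset (n G) → Fin (n G) → Set
Neighbour G C v = v ∉ C × ∃[ c ] (c ∈ C × adj G c v ≡ true)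

module _ {G : Graph} (𝒟 : TreeDecomposition G ∅) {C : Subset (n G)}
         (C-comp : IsComponentOutside G (X 𝒟) C)
         (Q : Subset (n G)) (Q⊆C : Q ⊆ C) where

  private
    C∩X : ∀ {v} → v ∈ C → v ∉ X 𝒟
    C∩X = proj₁ (proj₂ C-comp) _

    C-closed : ∀ {c v} → c ∈ C → v ∉ X 𝒟 → adj G c v ≡ true → v ∈ C
    C-closed = proj₂ (proj₂ (proj₂ C-comp)) _ _

  -- If `C′` misses `C`, it has no neighbour in `Q ⊆ C`, so it was a component before. If it meets
  -- `C`, connectedness keeps it inside `C`, and its neighbours in `C` can only be in `Q`.
  old-or-inside : ∀ C′ → IsComponentOutside G (X 𝒟 ∪ Q) C′ →
    IsComponentOutside G (X 𝒟) C′
    ⊎ (C′ ⊆ C × (∀ v → Neighbour G C′ v → v ∈ Q ⊎ Neighbour G C v))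
  old-or-inside C′ (ne , C′∩X∪Q , con , closed) with any? (λ v → v ∈? C ×-dec v ∈? C′)
  ... | no ¬i = inj₁ (ne , (λ v i → C′∩X∪Q v i ∘ x∈p∪q⁺ ∘ inj₁) , con , closed′)
    where
    closed′ : ∀ c v → c ∈ C′ → v ∉ X 𝒟 → adj G c v ≡ true → v ∈ C′
    closed′ c v c∈C′ v∉X e = closed c v c∈C′ (λ i → case x∈p∪q⁻ (X 𝒟) Q i of λ
      { (inj₁ v∈X) → v∉X v∈X
      ; (inj₂ v∈Q) → ¬i (c , C-closed (Q⊆C v∈Q) (C′∩X∪Q c c∈C′ ∘ x∈p∪q⁺ ∘ inj₁)
          (trans (sym G v c) e) , c∈C′) }) e
  ... | yes (c₀ , c₀∈C , c₀∈C′) = inj₂ (C′⊆C , neighbours)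
    where
    C′⊆C : C′ ⊆ C
    C′⊆C {v} v∈C′ = invariant
      (λ _ v∈C′ e u∈C → C-closed u∈C (C′∩X∪Q _ v∈C′ ∘ x∈p∪q⁺ ∘ inj₁) e)
      (con c₀ v c₀∈C′ v∈C′) c₀∈C

    neighbours : ∀ v → Neighbour G C′ v → v ∈ Q ⊎ Neighbour G C v
    neighbours v (v∉C′ , c , c∈C′ , e) with v ∈? C | v ∈? Q
    ... | no v∉C  | _       = inj₂ (v∉C , c , C′⊆C c∈C′ , e)
    ... | yes _   | yes v∈Q = inj₁ v∈Q
    ... | yes v∈C | no v∉Q  = contradiction
      (closed c v c∈C′ (λ i → [ C∩X v∈C , v∉Q ]′ (x∈p∪q⁻ (X 𝒟) Q i)) e) v∉C′

  module _ (p : Fin (n (T 𝒟))) (Y : Subset (n G)) (Y⊆W : Y ⊆ W 𝒟 p)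
           (N⊆Y : ∀ v → Neighbour G C v → v ∈ Y) where

    grown-bag : Fin (suc (n (T 𝒟))) → Subset (n G)
    grown-bag zero    = Y ∪ Q
    grown-bag (suc x) = W 𝒟 x

    -- The leaf `zero` carries `Y ∪ Q`. Old vertices adjacent to `Q` are neighbours of `C`, hence in
    -- `Y`. The type has `∅` in place of `S` because `S` may be only partly covered during the
    -- growth.
    grow : TreeDecomposition G ∅
    grow = record
      { X      = X 𝒟 ∪ Q
      ; S⊆X    = ⊥⊆
      ; T      = addLeaf (T 𝒟) p
      ; isTree = leaf-isTree (T 𝒟) p (isTree 𝒟)
      ; W      = grown-bag
      ; W⊆X    = bag⊆
      ; edge   = edge′
      ; vtxNe  = λ v i → case x∈p∪q⁻ (X 𝒟) Q i of λ
          { (inj₁ v∈X) → let x , v∈W = vtxNe 𝒟 v v∈X in suc x , v∈W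
          ; (inj₂ v∈Q) → zero , Q⊆bag v∈Q }
      ; vtxCon = λ v _ → con v
      ; comp   = comp′ }
      where
      Q⊆bag : ∀ {v} → v ∈ Q → v ∈ Y ∪ Q
      Q⊆bag = x∈p∪q⁺ ∘ inj₂

      Y⊆bag : ∀ {v} → v ∈ Y → v ∈ Y ∪ Q
      Y⊆bag = x∈p∪q⁺ ∘ inj₁

      bag⊆ : ∀ x → grown-bag x ⊆ X 𝒟 ∪ Q
      bag⊆ zero    i = x∈p∪q⁺ (Sum.map₁ (W⊆X 𝒟 p ∘ Y⊆W) (x∈p∪q⁻ Y Q i))
      bag⊆ (suc x) i = x∈p∪q⁺ (inj₁ (W⊆X 𝒟 x i))

      X-neighbour : ∀ {u v} → u ∈ X 𝒟 → v ∈ Q → adj G v u ≡ true → u ∈ Y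
      X-neighbour u∈X v∈Q e = N⊆Y _ ((λ u∈C → C∩X u∈C u∈X) , _ , Q⊆C v∈Q , e)

      edge′ : ∀ u v → u ∈ X 𝒟 ∪ Q → v ∈ X 𝒟 ∪ Q → adj G u v ≡ true →
        ∃[ x ] (u ∈ grown-bag x × v ∈ grown-bag x)
      edge′ u v i j e with x∈p∪q⁻ (X 𝒟) Q i | x∈p∪q⁻ (X 𝒟) Q j
      ... | inj₁ u∈X | inj₁ v∈X = let x , u∈W , v∈W = edge 𝒟 u v u∈X v∈X e in suc x , u∈W , v∈W
      ... | inj₁ u∈X | inj₂ v∈Q =
        zero , Y⊆bag (X-neighbour u∈X v∈Q (trans (sym G v u) e)) , Q⊆bag v∈Q
      ... | inj₂ u∈Q | inj₁ v∈X = zero , Q⊆bag u∈Q , Y⊆bag (X-neighbour v∈X u∈Q e)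
      ... | inj₂ u∈Q | inj₂ v∈Q = zero , Q⊆bag u∈Q , Q⊆bag v∈Q

      to-p : ∀ {v x} → v ∈ Y ∪ Q → v ∈ W 𝒟 x → v ∈ W 𝒟 p
      to-p i v∈W with x∈p∪q⁻ Y Q i
      ... | inj₁ v∈Y = Y⊆W v∈Y
      ... | inj₂ v∈Q = contradiction (W⊆X 𝒟 _ v∈W) (C∩X (Q⊆C v∈Q))

      con : ∀ v → ConnectedIn (addLeaf (T 𝒟) p) (λ x → v ∈ grown-bag x)
      con v zero    zero    i j = here i
      con v zero    (suc y) i j = let k = to-p {x = y} i j in
        step i (p-adj-zero (T 𝒟) p)
          (lift-walk (T 𝒟) p id (vtxCon 𝒟 v (W⊆X 𝒟 y j) p y k j))
      con v (suc x) zero    i j = let k = to-p {x = x} j i in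
        snoc (lift-walk (T 𝒟) p id (vtxCon 𝒟 v (W⊆X 𝒟 x i) x p i k)) (p-adj-zero (T 𝒟) p) j
      con v (suc x) (suc y) i j = lift-walk (T 𝒟) p id (vtxCon 𝒟 v (W⊆X 𝒟 x i) x y i j)

      comp′ : ∀ C′ → IsComponentOutside G (X 𝒟 ∪ Q) C′ →
        Σ (Fin (suc (n (T 𝒟)))) λ x → ∀ v → v ∉ C′ →
          ∃[ c ] (c ∈ C′ × adj G c v ≡ true) → v ∈ grown-bag x
      comp′ C′ C′-comp with old-or-inside C′ C′-comp
      ... | inj₁ old      = let x , h = comp 𝒟 C′ old in suc x , h
      ... | inj₂ (_ , nb) = zero , λ v v∉C′ a → x∈p∪q⁺ ([ inj₂ , inj₁ ∘ N⊆Y v ]′ (nb v (v∉C′ , a)))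

-- Splitting along a separation when there is no tangle

∣p∪q∣≤∣p∣+∣q∣ : ∀ {m} (p q : Subset m) → ∣ p ∪ q ∣ ≤ ∣ p ∣ + ∣ q ∣
∣p∪q∣≤∣p∣+∣q∣ []            []            = z≤n
∣p∪q∣≤∣p∣+∣q∣ (inside  ∷ p) (inside  ∷ q) = s≤s (≤-trans (∣p∪q∣≤∣p∣+∣q∣ p q) (+-monoʳ-≤ ∣ p ∣ (n≤1+n _)))
∣p∪q∣≤∣p∣+∣q∣ (inside  ∷ p) (outside ∷ q) = s≤s (∣p∪q∣≤∣p∣+∣q∣ p q)
∣p∪q∣≤∣p∣+∣q∣ (outside ∷ p) (inside  ∷ q) =
  ≤-trans (s≤s (∣p∪q∣≤∣p∣+∣q∣ p q)) (≤-reflexive (≡-sym (+-suc _ _)))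
∣p∪q∣≤∣p∣+∣q∣ (outside ∷ p) (outside ∷ q) = ∣p∪q∣≤∣p∣+∣q∣ p q

∣p∩q∣+∣p∩∁q∣≡∣p∣ : ∀ {m} (p q : Subset m) → ∣ p ∩ q ∣ + ∣ p ∩ ∁ q ∣ ≡ ∣ p ∣
∣p∩q∣+∣p∩∁q∣≡∣p∣ []            []            = refl
∣p∩q∣+∣p∩∁q∣≡∣p∣ (inside  ∷ p) (inside  ∷ q) = cong suc (∣p∩q∣+∣p∩∁q∣≡∣p∣ p q)
∣p∩q∣+∣p∩∁q∣≡∣p∣ (inside  ∷ p) (outside ∷ q) = trans (+-suc _ _) (cong suc (∣p∩q∣+∣p∩∁q∣≡∣p∣ p q))
∣p∩q∣+∣p∩∁q∣≡∣p∣ (outside ∷ p) (_       ∷ q) = ∣p∩q∣+∣p∩∁q∣≡∣p∣ p q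

order-swap : ∀ {G} (s : Separation G) → order (swap s) ≡ order s
order-swap s = cong ∣_∣ (∩-comm (V (B s)) (V (A s)))

-- An edge of `B s` at a vertex of `C` in `A s` would put that vertex on both sides. So all edges
-- there belong to `A s`, and neither walks in `C` nor a step out of `C` can leave `V (A s)`.
confined : ∀ {G} (s : Separation G) {C} → ConnectedIn G (_∈ C) →
  (∀ {v} → v ∈ C → v ∈ V (A s) → v ∉ V (B s)) → ∀ {c} → c ∈ C → c ∈ V (A s) →
  ∀ {v} → v ∈ C ⊎ Neighbour G C v → v ∈ V (A s)
confined {G} s {C} con apart {c} c∈C c∈A = [ inside-C , outside-C ]′
  where
  move : ∀ {u v} → u ∈ C → u ∈ V (A s) → adj G u v ≡ true → v ∈ V (A s)
  move {u} {v} u∈C u∈A e with coverE s u v e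
  ... | inj₁ eA = proj₂ (Eend (A s) u v eA)
  ... | inj₂ eB = contradiction (proj₁ (Eend (B s) u v eB)) (apart u∈C u∈A)

  inside-C : ∀ {v} → v ∈ C → v ∈ V (A s)
  inside-C v∈C = invariant (λ u∈C _ e u∈A → move u∈C u∈A e) (con c _ c∈C v∈C) c∈A

  outside-C : ∀ {v} → Neighbour G C v → v ∈ V (A s)
  outside-C (_ , u , u∈C , e) = move u∈C (inside-C u∈C) e

module _ (G : Graph) (S : Subset (n G)) (θ : ℕ) (no-tangle : ¬ HasTangle G S (suc θ)) where

  -- Components still to be decomposed have at most M neighbours, bags have size at most M + θ.
  M : ℕ
  M = suc (θ + (θ + θ))

  -- The two alternatives are the failures of (T1) and (T4) for the candidate tangle in
  -- `splitting-separation`.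
  Splits : Subset (n G) → Separation G → Set
  Splits Y s = order s ≤ θ ×
    ((θ < ∣ Y ∩ V (A s) ∣ × θ < ∣ Y ∩ V (B s) ∣) ⊎ (∣ Y ∩ V (A s) ∣ ≤ θ × S ⊆ V (A s)))

  -- Otherwise the separations with few vertices of Y on the first side form a tangle of order θ + 1:
  -- three such sides contain at most 3 θ < M vertices of Y.
  splitting-separation : ∀ Y → ∣ Y ∣ ≡ M → ¬ ¬ ∃ (Splits Y)
  splitting-separation Y ∣Y∣≡M none = no-tangle (𝒯 , record
    { ord = λ s → s≤s ∘ proj₁
    ; T1  = t1
    ; T2  = λ s₁ s₂ s₃ (_ , h₁) (_ , h₂) (_ , h₃) (cover , _) →
        n≮n (θ + (θ + θ)) (≤-trans (covered s₁ s₂ s₃ cover) (+-mono-≤ h₁ (+-mono-≤ h₂ h₃)))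
    ; T3  = λ s t all → t4 s t λ _ → all _
    ; T4  = t4 })
    where
    𝒯 : Separation G → Set
    𝒯 s = order s ≤ θ × ∣ Y ∩ V (A s) ∣ ≤ θ

    t1 : ∀ s → order s ≤ θ → 𝒯 s ⊎ 𝒯 (swap s)
    t1 s o with ∣ Y ∩ V (A s) ∣ ≤? θ | ∣ Y ∩ V (B s) ∣ ≤? θ
    ... | yes h | _     = inj₁ (o , h)
    ... | no _  | yes h = inj₂ (≤-trans (≤-reflexive (order-swap s)) o , h)
    ... | no ¬h | no ¬k = contradiction (s , o , inj₁ (≰⇒> ¬h , ≰⇒> ¬k)) none

    t4 : ∀ s → 𝒯 s → ¬ (S ⊆ V (A s))
    t4 s (o , h) S⊆A = none (s , o , inj₂ (h , S⊆A))

    covered : ∀ s₁ s₂ s₃ → (∀ v → v ∈ V (A s₁) ⊎ v ∈ V (A s₂) ⊎ v ∈ V (A s₃)) →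
      M ≤ ∣ Y ∩ V (A s₁) ∣ + (∣ Y ∩ V (A s₂) ∣ + ∣ Y ∩ V (A s₃) ∣)
    covered s₁ s₂ s₃ cover = ≤-trans (≤-reflexive (≡-sym ∣Y∣≡M))
      (≤-trans (p⊆q⇒∣p∣≤∣q∣ {q = (Y ∩ V (A s₁)) ∪ ((Y ∩ V (A s₂)) ∪ (Y ∩ V (A s₃)))} sub)
      (≤-trans (∣p∪q∣≤∣p∣+∣q∣ (Y ∩ V (A s₁)) _) (+-monoʳ-≤ _ (∣p∪q∣≤∣p∣+∣q∣ (Y ∩ V (A s₂)) _))))
      where
      sub : Y ⊆ (Y ∩ V (A s₁)) ∪ ((Y ∩ V (A s₂)) ∪ (Y ∩ V (A s₃)))
      sub {v} v∈Y with cover v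
      ... | inj₁ i        = x∈p∪q⁺ (inj₁ (x∈p∩q⁺ (v∈Y , i)))
      ... | inj₂ (inj₁ i) = x∈p∪q⁺ (inj₂ (x∈p∪q⁺ (inj₁ (x∈p∩q⁺ (v∈Y , i)))))
      ... | inj₂ (inj₂ i) = x∈p∪q⁺ (inj₂ (x∈p∪q⁺ (inj₂ (x∈p∩q⁺ (v∈Y , i)))))

  FewNeighbours : Subset (n G) → Set
  FewNeighbours C = Σ (Subset (n G)) λ Y → (∀ v → Neighbour G C v → v ∈ Y) × ∣ Y ∣ ≤ M

  -- The hypotheses of `few` are what is known of a new component inside `C`; `nonempty` makes the
  -- growth terminate.
  record Refinement (C Y : Subset (n G)) : Set where
    field
      Q        : Subset (n G)
      Q⊆C      : Q ⊆ C
      nonempty : ∃[ v ] v ∈ Q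
      bag-size : ∣ Y ∪ Q ∣ ≤ M + θ
      few      : ∀ C′ → ConnectedIn G (_∈ C′) → C′ ⊆ C → (∀ {v} → v ∈ C′ → v ∉ Q) →
        (∀ v → Neighbour G C′ v → v ∈ Q ⊎ Neighbour G C v) →
        ∀ r → r ∈ S → r ∈ C′ → FewNeighbours C′

  module _ {C Y : Subset (n G)} (con : ConnectedIn G (_∈ C)) (hY : Represents Y (Neighbour G C))
           {r : Fin (n G)} (r∈S : r ∈ S) (r∈C : r ∈ C) where

    -- `Y` together with `r` serves both as the new bag and as the bound for all neighbourhoods that
    -- arise inside `C`.
    add-vertex : ∣ Y ∣ < M → Refinement C Y
    add-vertex ∣Y∣<M = record
      { Q        = ⁅ r ⁆
      ; Q⊆C      = λ i → subst (_∈ C) (≡-sym (x∈⁅y⁆⇒x≡y r i)) r∈C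
      ; nonempty = r , x∈⁅x⁆ r
      ; bag-size = ≤-trans small (m≤m+n M θ)
      ; few      = λ C′ _ _ _ nb _ _ _ → Y ∪ ⁅ r ⁆ ,
          (λ v h → x∈p∪q⁺ ([ inj₂ , inj₁ ∘ proj₂ (hY v) ]′ (nb v h))) , small }
      where
      small : ∣ Y ∪ ⁅ r ⁆ ∣ ≤ M
      small = ≤-trans (∣p∪q∣≤∣p∣+∣q∣ Y ⁅ r ⁆)
        (≤-trans (≤-reflexive (trans (cong (∣ Y ∣ +_) (∣⁅x⁆∣≡1 r)) (+-comm _ 1))) ∣Y∣<M)

    side : Separation G → Subset (n G)
    side s = (Y ∩ V (A s)) ∪ (V (A s) ∩ V (B s))

    -- More than `θ` of the `3 θ + 1` vertices of `Y` are in `V (B s)`, so at most `2 θ` are outside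
    -- it. The rest of `side s` lies in the separator, which adds at most `θ`.
    side-size : ∀ s → ∣ Y ∣ ≡ M → order s ≤ θ → θ < ∣ Y ∩ V (B s) ∣ → ∣ side s ∣ ≤ M
    side-size s ∣Y∣≡M o big =
      ≤-trans (p⊆q⇒∣p∣≤∣q∣ {q = (Y ∩ ∁ (V (B s))) ∪ (V (A s) ∩ V (B s))} sub)
      (≤-trans (∣p∪q∣≤∣p∣+∣q∣ (Y ∩ ∁ (V (B s))) _)
      (≤-trans (+-mono-≤ rest o) (≤-trans (≤-reflexive (+-comm (θ + θ) θ)) (n≤1+n _))))
      where
      rest : ∣ Y ∩ ∁ (V (B s)) ∣ ≤ θ + θ
      rest = +-cancelˡ-≤ (suc θ) _ _ (≤-trans (+-monoˡ-≤ _ big)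
        (≤-reflexive (trans (∣p∩q∣+∣p∩∁q∣≡∣p∣ Y (V (B s))) ∣Y∣≡M)))

      sub : side s ⊆ (Y ∩ ∁ (V (B s))) ∪ (V (A s) ∩ V (B s))
      sub {v} i with x∈p∪q⁻ (Y ∩ V (A s)) _ i
      ... | inj₂ j = x∈p∪q⁺ (inj₂ j)
      ... | inj₁ j with v ∈? V (B s) | x∈p∩q⁻ Y (V (A s)) j
      ...   | yes v∈B | _   , v∈A = x∈p∪q⁺ (inj₂ (x∈p∩q⁺ (v∈A , v∈B)))
      ...   | no v∉B  | v∈Y , _   = x∈p∪q⁺ (inj₁ (x∈p∩q⁺ (v∈Y , x∉p⇒x∈∁p v∉B)))

    side-neighbours : ∀ (s : Separation G) C′ {Q} → ConnectedIn G (_∈ C′) →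
      (∀ {v} → v ∈ Q → v ∈ V (A s) × v ∈ V (B s)) →
      (∀ {v} → v ∈ C′ → v ∈ V (A s) → v ∉ V (B s)) →
      (∀ v → Neighbour G C′ v → v ∈ Q ⊎ Neighbour G C v) →
      ∀ {c} → c ∈ C′ → c ∈ V (A s) → ∀ v → Neighbour G C′ v → v ∈ side s
    side-neighbours s C′ con′ Q⊆ apart nb c∈C′ c∈A v h with nb v h
    ... | inj₁ v∈Q = x∈p∪q⁺ (inj₂ (x∈p∩q⁺ (Q⊆ v∈Q)))
    ... | inj₂ h′  = x∈p∪q⁺ (inj₁ (x∈p∩q⁺ (proj₂ (hY v) h′ , confined s con′ apart c∈C′ c∈A (inj₂ h))))

    within : ∀ (s : Separation G) → (∀ {v} → v ∈ C → v ∈ V (A s) → v ∉ V (B s)) → r ∈ V (A s) → Y ⊆ V (A s)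
    within s apart r∈A v∈Y = confined s con apart r∈C r∈A (inj₂ (proj₁ (hY _) v∈Y))

    split : ∣ Y ∣ ≡ M → ∀ s → Splits Y s → Refinement C Y
    split ∣Y∣≡M s (o , alternatives) = record
      { Q        = Q
      ; Q⊆C      = proj₁ ∘ x∈p∩q⁻ C _
      ; nonempty = nonempty
      ; bag-size = ≤-trans (∣p∪q∣≤∣p∣+∣q∣ Y Q)
          (+-mono-≤ (≤-reflexive ∣Y∣≡M) (≤-trans (∣p∩q∣≤∣q∣ C _) o))
      ; few      = few }
      where
      Q : Subset (n G)
      Q = C ∩ (V (A s) ∩ V (B s))

      Q⊆ : ∀ {v} → v ∈ Q → v ∈ V (A s) × v ∈ V (B s)
      Q⊆ i = x∈p∩q⁻ (V (A s)) (V (B s)) (proj₂ (x∈p∩q⁻ C _ i))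

      o′ : order (swap s) ≤ θ
      o′ = ≤-trans (≤-reflexive (order-swap s)) o

      within-absurd : ∀ (s : Separation G) → order s ≤ θ → θ < ∣ Y ∩ V (B s) ∣ → ¬ (Y ⊆ V (A s))
      within-absurd s o big Y⊆A = n≮n θ (≤-trans big (≤-trans (p⊆q⇒∣p∣≤∣q∣ λ i →
        let v∈Y , v∈B = x∈p∩q⁻ Y (V (B s)) i in x∈p∩q⁺ (Y⊆A v∈Y , v∈B)) o))

      -- Were `Q` empty, `C` and all of `Y` would lie on one side. If both sides are big, the more
      -- than `θ` vertices of `Y` on the other side would lie in the separator. If `S ⊆ V (A s)`,
      -- all `3 θ + 1` vertices of `Y` would lie in `V (A s)`, which has at most `θ` of them.
      apart-absurd : (∀ {v} → v ∈ C → v ∈ V (A s) → v ∉ V (B s)) → ⊥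
      apart-absurd apart = [ both-big , S-on-one-side ]′ alternatives
        where
        both-big : θ < ∣ Y ∩ V (A s) ∣ × θ < ∣ Y ∩ V (B s) ∣ → ⊥
        both-big (bigA , bigB) with coverV s r
        ... | inj₁ r∈A = within-absurd s o bigB (within s apart r∈A)
        ... | inj₂ r∈B = within-absurd (swap s) o′ bigA
          (within (swap s) (λ v∈C v∈B v∈A → apart v∈C v∈A v∈B) r∈B)

        S-on-one-side : ∣ Y ∩ V (A s) ∣ ≤ θ × S ⊆ V (A s) → ⊥
        S-on-one-side (few , S⊆A) = n≮n θ (≤-trans (s≤s (m≤m+n θ (θ + θ)))
          (≤-trans (≤-reflexive (≡-sym ∣Y∣≡M)) (≤-trans (p⊆q⇒∣p∣≤∣q∣ λ v∈Y →
            x∈p∩q⁺ (v∈Y , within s apart (S⊆A r∈S) v∈Y)) few)))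

      nonempty : ∃[ v ] v ∈ Q
      nonempty with nonempty? Q
      ... | yes ne = ne
      ... | no ¬ne = ⊥-elim (apart-absurd λ v∈C v∈A v∈B →
        ¬ne (_ , x∈p∩q⁺ (v∈C , x∈p∩q⁺ (v∈A , v∈B))))

      few : ∀ C′ → ConnectedIn G (_∈ C′) → C′ ⊆ C → (∀ {v} → v ∈ C′ → v ∉ Q) →
        (∀ v → Neighbour G C′ v → v ∈ Q ⊎ Neighbour G C v) →
        ∀ r′ → r′ ∈ S → r′ ∈ C′ → FewNeighbours C′
      few C′ con′ C′⊆C C′∩Q nb r′ r′∈S r′∈C′ = [ both-big , S-on-one-side ]′ alternatives
        where
        apart : ∀ {v} → v ∈ C′ → v ∈ V (A s) → v ∉ V (B s)
        apart v∈C′ v∈A v∈B = C′∩Q v∈C′ (x∈p∩q⁺ (C′⊆C v∈C′ , x∈p∩q⁺ (v∈A , v∈B)))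

        both-big : θ < ∣ Y ∩ V (A s) ∣ × θ < ∣ Y ∩ V (B s) ∣ → FewNeighbours C′
        both-big (bigA , bigB) with coverV s r′
        ... | inj₁ r′∈A = side s , side-neighbours s C′ con′ Q⊆ apart nb r′∈C′ r′∈A ,
          side-size s ∣Y∣≡M o bigB
        ... | inj₂ r′∈B = side (swap s) ,
          side-neighbours (swap s) C′ con′ (Product.swap ∘ Q⊆)
            (λ v∈C′ v∈B v∈A → apart v∈C′ v∈A v∈B) nb r′∈C′ r′∈B ,
          side-size (swap s) ∣Y∣≡M o′ bigA

        -- Since `C′` meets `S`, it is on the side `A s`, where `Y` and the separator contribute at
        -- most `θ` each.
        S-on-one-side : ∣ Y ∩ V (A s) ∣ ≤ θ × S ⊆ V (A s) → FewNeighbours C′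
        S-on-one-side (few , S⊆A) =
          side s , side-neighbours s C′ con′ Q⊆ apart nb r′∈C′ (S⊆A r′∈S) ,
          ≤-trans (∣p∪q∣≤∣p∣+∣q∣ (Y ∩ V (A s)) _)
          (≤-trans (+-mono-≤ few o) (≤-trans (m≤n+m (θ + θ) θ) (n≤1+n _)))

    refinement : ∣ Y ∣ ≤ M → ¬ ¬ Refinement C Y
    refinement ∣Y∣≤M k with m≤n⇒m<n∨m≡n ∣Y∣≤M
    ... | inj₁ ∣Y∣<M = k (add-vertex ∣Y∣<M)
    ... | inj₂ ∣Y∣≡M = splitting-separation Y ∣Y∣≡M λ (s , h) → k (split ∣Y∣≡M s h)

  -- Iterating the growth until `S` is covered

  BagsBounded : ∀ {S′} → TreeDecomposition G S′ → Set
  BagsBounded 𝒟 = ∀ x → ∣ W 𝒟 x ∣ ≤ M + θ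

  -- Only components meeting `S` are controlled; the others may stay outside `X 𝒟` for good.
  FewOutside : TreeDecomposition G ∅ → Set
  FewOutside 𝒟 = ∀ C → IsComponentOutside G (X 𝒟) C → ∀ r → r ∈ S → r ∈ C → FewNeighbours C

  exhaust : ∀ 𝒟 → BagsBounded 𝒟 → FewOutside 𝒟 → Acc _<_ ∣ ∁ (X 𝒟) ∣ →
    ¬ ¬ Σ (TreeDecomposition G S) BagsBounded
  exhaust 𝒟 bags few (acc rec) k with any? (λ v → v ∈? S ×-dec ¬? (v ∈? X 𝒟))
  ... | no ¬r = k (record
    { X = X 𝒟 ; S⊆X = S⊆X′ ; T = T 𝒟 ; isTree = isTree 𝒟 ; W = W 𝒟 ; W⊆X = W⊆X 𝒟
    ; edge = edge 𝒟 ; vtxNe = vtxNe 𝒟 ; vtxCon = vtxCon 𝒟 ; comp = comp 𝒟 } , bags)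
    where
    S⊆X′ : S ⊆ X 𝒟
    S⊆X′ {v} v∈S with v ∈? X 𝒟
    ... | yes i = i
    ... | no ¬i = contradiction (v , v∈S , ¬i) ¬r
  ... | yes (r , r∈S , r∉X) =
    comprehension (Outside 𝒟 r) λ (C , hC) →
    comprehension (Neighbour G C) λ (Y , hY) →
    let C-comp@(_ , C∩X , con , _) = component-of 𝒟 r∉X hC
        r∈C = proj₂ (hC r) (here r∉X)
        Y₀ , N⊆Y₀ , ∣Y₀∣≤M = few C C-comp r r∈S r∈C
    in refinement con hY r∈S r∈C (≤-trans (p⊆q⇒∣p∣≤∣q∣ λ i → N⊆Y₀ _ (proj₁ (hY _) i)) ∣Y₀∣≤M) λ ref →
    let open Refinement ref renaming (few to few′)
        p , N⊆W = comp 𝒟 C C-comp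
        Y⊆W : Y ⊆ W 𝒟 p
        Y⊆W i = let v∉C , a = proj₁ (hY _) i in N⊆W _ v∉C a
        𝒟′ = grow 𝒟 C-comp Q Q⊆C p Y Y⊆W (λ v → proj₂ (hY v))
        q , q∈Q = nonempty
    in exhaust 𝒟′
      (λ { zero → bag-size ; (suc x) → bags x })
      (λ C′ C′-comp r′ r′∈S r′∈C′ → case old-or-inside 𝒟 C-comp Q Q⊆C C′ C′-comp of λ
        { (inj₁ old) → few C′ old r′ r′∈S r′∈C′
        ; (inj₂ (C′⊆C , nb)) → few′ C′ (proj₁ (proj₂ (proj₂ C′-comp))) C′⊆C
            (λ v∈C′ v∈Q → proj₁ (proj₂ C′-comp) _ v∈C′ (x∈p∪q⁺ (inj₂ v∈Q))) nb r′ r′∈S r′∈C′ })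
      -- The complement of `X` shrinks, as `Q` is non-empty and disjoint from `X 𝒟`.
      (rec (p⊂q⇒∣p∣<∣q∣
        ( (λ i → x∉p⇒x∈∁p (x∈∁p⇒x∉p i ∘ x∈p∪q⁺ ∘ inj₁))
        , q , x∉p⇒x∈∁p (C∩X q (Q⊆C q∈Q)) , x∈p⇒x∉∁p (x∈p∪q⁺ (inj₂ q∈Q)))))
      k

  point : Graph
  point = record { n = 1 ; adj = λ _ _ → false ; sym = λ _ _ → refl ; irrefl = λ _ → refl }

  point-isTree : IsTree point
  point-isTree = s≤s z≤n , (λ { zero zero _ _ → here tt }) , λ
    { _ [] (_ , () , _) ; _ (_ ∷ _) (_ , _ , () ∷ _) }

  no-neighbours : ∀ {C : Subset (n G)} → IsComponentOutside G ∅ C → ∀ v → ¬ Neighbour G C v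
  no-neighbours (_ , _ , _ , closed) v (v∉C , c , c∈C , e) = v∉C (closed c v c∈C ∉⊥ e)

  initial : TreeDecomposition G ∅
  initial = record
    { X = ∅ ; S⊆X = id ; T = point ; isTree = point-isTree ; W = λ _ → ∅ ; W⊆X = λ _ → id
    ; edge = λ u v i → contradiction i ∉⊥
    ; vtxNe = λ v i → contradiction i ∉⊥
    ; vtxCon = λ v i → contradiction i ∉⊥
    ; comp = λ C C-comp → zero , λ v v∉C a → contradiction (v∉C , a) (no-neighbours C-comp v) }

  small-decomposition : ¬ ¬ Σ (TreeDecomposition G S) BagsBounded
  small-decomposition = exhaust initial
    (λ _ → ≤-trans ∣∅∣≤0 z≤n)
    (λ C C-comp _ _ _ → ∅ , (λ v h → contradiction h (no-neighbours C-comp v)) , ≤-trans ∣∅∣≤0 z≤n)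
    (<-wellFounded _)
    where
    ∣∅∣≤0 : ∣ ∅ {n G} ∣ ≤ 0
    ∣∅∣≤0 = ≤-reflexive (∣⊥∣≡0 (n G))

-- The two inequalities

≤-maxOver : ∀ m (f : Fin m → ℕ) i → f i ≤ maxOver m f
≤-maxOver (suc m) f zero    = m≤m⊔n _ _
≤-maxOver (suc m) f (suc i) = ≤-trans (≤-maxOver m (f ∘ suc) i) (m≤n⊔m _ _)

maxOver-≤ : ∀ m (f : Fin m → ℕ) {b} → (∀ i → f i ≤ b) → maxOver m f ≤ b
maxOver-≤ zero    f h = z≤n
maxOver-≤ (suc m) f h = ⊔-lub (h zero) (maxOver-≤ m (f ∘ suc) (h ∘ suc))

tangle-order≤bag : ∀ {G S t} (𝒟 : TreeDecomposition G S) → t ≡ 0 ⊎ (1 ≤ t × HasTangle G S t) →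
  t ≤ maxOver (n (T 𝒟)) (λ x → ∣ W 𝒟 x ∣)
tangle-order≤bag 𝒟 (inj₁ refl) = z≤n
tangle-order≤bag 𝒟 (inj₂ (s≤s _ , _ , tangle)) = ≰⇒> λ bags≤k →
  tangle⇒large-bag tangle 𝒟 λ x → ≤-trans (≤-maxOver _ (λ x → ∣ W 𝒟 x ∣) x) bags≤k

-- Equality holds at θ = 2.
bag-bound : ∀ θ → 2 ≤ θ → 11 + (suc (θ + (θ + θ)) + θ) ≤ 10 * θ
bag-bound (suc (suc r)) _ = ≤-trans (m≤m+n _ (6 * r)) (≤-reflexive (identity r))
  where
  identity : ∀ r → 11 + (suc ((2 + r) + ((2 + r) + (2 + r))) + (2 + r)) + 6 * r ≡ 10 * (2 + r)
  identity = solve-∀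
bag-bound (suc zero) (s≤s ())

theorem3p6 : (G : Graph) → 1 ≤ n G → (S : Subset (n G)) →
    (t : ℕ) → (w : ℤ) → IsTn G S t → IsTw G S w →
    (t ⊖ 1 Data.Integer.≤ w) × (w Data.Integer.≤ (10 * (t ⊔ 2)) ⊖ 12)
theorem3p6 G _ S t w (t-max , t-attained) ((𝒟 , width≡w) , w-min) =
  subst (t ⊖ 1 Data.Integer.≤_) width≡w (⊖-monoˡ-≤ 1 (tangle-order≤bag 𝒟 t-attained)) ,
  decidable-stable (w ℤ.≤? _) λ ¬upper →
    small-decomposition G S θ no-tangle λ (𝒟′ , bags) → ¬upper
      (ℤ.≤-trans (w-min 𝒟′)
      (ℤ.≤-trans (⊖-monoˡ-≤ 1 (maxOver-≤ _ _ bags))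
      -- Adding `11` to both arguments of `⊖` turns the width bound `(4 θ + 1) ⊖ 1` into
      -- `(4 θ + 12) ⊖ 12`.
      (ℤ.≤-trans (ℤ.≤-reflexive (≡-sym (+-cancelˡ-⊖ 11 (suc (θ + (θ + θ)) + θ) 1)))
        (⊖-monoˡ-≤ 12 (bag-bound θ (m≤n⊔m t 2))))))
  where
  -- The bound `4 θ + 1 ≤ 10 θ − 11` holds from `2` on, whence the maximum.
  θ : ℕ
  θ = t ⊔ 2

  no-tangle : ¬ HasTangle G S (suc θ)
  no-tangle h = n≮n t (≤-trans (s≤s (m≤m⊔n t 2)) (t-max (suc θ) (s≤s z≤n) h))
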